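{- Let $n\ge 1$ and let $a_1,\ldots,a_n$ be integers with $a_i \ge i$ for all $i=1,\ldots,n$. Then the simplicial complex $\Sigma(\Psi_{a_n,\ldots,a_1})$ of non-attacking rook placements on the triangular board $\Psi_{a_n,\ldots,a_1}$ is vertex decomposable.
   Context: For positive integers $a_1,\ldots,a_n$, the triangular board $\Psi_{a_n,\ldots,a_1}$ is the left-justified board with $a_i$ rows of length $i$ for each $1\le i\le n$ (the Ferrers board of the partition $(n^{a_n},\ldots,1^{a_1})$). Its $p=\sum_{i=1}^n a_i$ rows are numbered $1,\ldots,p$ from bottom to top, with row lengths weakly increasing from bottom to top; columns are numbered from left to right, and square $(i,j)$ is the one in column $i$ and row $j$. A non-attacking rook placement is a set of squares of the board, no two in the same row and no two in the same column. $\Sigma(\Psi_{a_n,\ldots,a_1})$ is the simplicial complex whose vertices are the squares and whose faces are the non-attacking rook placements (including the empty one). For a simplicial complex $\Delta$ and a vertex $x$: $\operatorname{lk}_\Delta(x)=\{\tau\in\Delta : x\notin\tau,\ \tau\cup\{x\}\in\Delta\}$ and $\operatorname{del}_\Delta(x)=\{\tau\in\Delta : x\notin\tau\}$. Vertex decomposability is defined recursively: (1) every simplex (including $\emptyset$ and $\{\emptyset\}$) is vertex decomposable; (2) $\Delta$ is vertex decomposable if $\Delta$ is pure (all facets have the same dimension) and contains a vertex $x$ such that $\operatorname{del}_\Delta(x)$ and $\operatorname{lk}_\Delta(x)$ are both vertex decomposable. -}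

module Defs where

open import Data.Nat.Base using (ℕ; suc; _*_; _+_; _<_)
open import Data.Integer.Base using (ℤ; _⊖_)
open import Data.Fin.Base using (Fin; zero; suc; toℕ; remQuot)
open import Data.Fin.Subset using (Subset; _∈_; _∉_; _⊆_; _∪_; ⁅_⁆; ∣_∣)
open import Data.Fin.Subset.Properties using (p⊆p∪q; q⊆p∪q; x∈p∪q⁻)
open import Data.List.Base using (List; concat; replicate; tabulate; length; lookup; sum)
open import Data.List.Properties using (length-++; length-replicate)
open import Data.Product.Base using (_×_; _,_; ∃; proj₁; proj₂)
open import Data.Sum.Base using (_⊎_; [_,_]′)
open import Function.Base using (_∘_)
open import Function.Bundles using (_⇔_)
open import Level using (0ℓ)
open import Relation.Binary.PropositionalEquality
  using (_≡_; _≢_; refl; cong; cong₂; trans)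
open import Relation.Nullary.Negation using (¬_)
open import Relation.Unary using (Pred)

-- Elements of the ambient set Fin N need not be vertices, and the void
-- complex (without even the empty face) is allowed.
record SimplicialComplex (N : ℕ) : Set₁ where
  field
    Face        : Subset N → Set
    down-closed : ∀ {σ τ} → τ ⊆ σ → Face σ → Face τ

open SimplicialComplex public

module _ {N : ℕ} where

  IsVertex : SimplicialComplex N → Fin N → Set
  IsVertex Δ x = Face Δ ⁅ x ⁆

  IsFacet : SimplicialComplex N → Subset N → Set
  IsFacet Δ σ = Face Δ σ × (∀ {τ} → Face Δ τ → σ ⊆ τ → τ ≡ σ)

  dim : Subset N → ℤ
  dim σ = ∣ σ ∣ ⊖ 1

  Pure : SimplicialComplex N → Set
  Pure Δ = ∀ {σ τ} → IsFacet Δ σ → IsFacet Δ τ → dim σ ≡ dim τ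

  -- Either the void complex ∅ or the complex of all subsets of some σ;
  -- the latter is {∅} when σ is empty.
  IsSimplex : SimplicialComplex N → Set
  IsSimplex Δ = (∀ τ → ¬ Face Δ τ) ⊎ ∃ λ σ → ∀ τ → Face Δ τ ⇔ τ ⊆ σ

  del : SimplicialComplex N → Fin N → SimplicialComplex N
  del Δ x .Face τ = Face Δ τ × x ∉ τ
  del Δ x .down-closed τ⊆σ (σ∈Δ , x∉σ) = down-closed Δ τ⊆σ σ∈Δ , λ x∈τ → x∉σ (τ⊆σ x∈τ)

  lk : SimplicialComplex N → Fin N → SimplicialComplex N
  lk Δ x .Face τ = Face Δ τ × x ∉ τ × Face Δ (τ ∪ ⁅ x ⁆)
  lk Δ x .down-closed {σ} {τ} τ⊆σ (σ∈Δ , x∉σ , σ∪x∈Δ) =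
    down-closed Δ τ⊆σ σ∈Δ , (λ x∈τ → x∉σ (τ⊆σ x∈τ)) , down-closed Δ τ∪x⊆σ∪x σ∪x∈Δ
    where
    τ∪x⊆σ∪x : τ ∪ ⁅ x ⁆ ⊆ σ ∪ ⁅ x ⁆
    τ∪x⊆σ∪x y∈ = [ (λ y∈τ → p⊆p∪q ⁅ x ⁆ (τ⊆σ y∈τ)) , q⊆p∪q σ ⁅ x ⁆ ]′ (x∈p∪q⁻ τ ⁅ x ⁆ y∈)

  data VertexDecomposable (Δ : SimplicialComplex N) : Set₁ where
    simplex : IsSimplex Δ → VertexDecomposable Δ
    shed    : Pure Δ → (x : Fin N) → IsVertex Δ x →
              VertexDecomposable (del Δ x) → VertexDecomposable (lk Δ x) →
              VertexDecomposable Δ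

-- A set of squares (i , j), with i the column (from the left) and j the row
-- (from the bottom), both counted from 0.
Board : ℕ → ℕ → Set₁
Board c r = Pred (Fin c × Fin r) 0ℓ

-- The squares of the c × r grid are coded as elements of Fin (c * r) by
-- combine : Fin c → Fin r → Fin (c * r), whose inverse is square.
module _ {c r : ℕ} where

  square : Fin (c * r) → Fin c × Fin r
  square = remQuot r

  column : Fin (c * r) → Fin c
  column = proj₁ ∘ square

  row : Fin (c * r) → Fin r
  row = proj₂ ∘ square

  NonAttacking : Subset (c * r) → Set
  NonAttacking σ = ∀ {x y} → x ∈ σ → y ∈ σ → x ≢ y → column x ≢ column y × row x ≢ row y

  rookComplex : Board c r → SimplicialComplex (c * r)
  rookComplex B .Face σ = (∀ {x} → x ∈ σ → B (square x)) × NonAttacking σ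
  rookComplex B .down-closed τ⊆σ (σ⊆B , na) =
    (λ x∈τ → σ⊆B (τ⊆σ x∈τ)) , λ x∈τ y∈τ → na (τ⊆σ x∈τ) (τ⊆σ y∈τ)

-- Row lengths from bottom to top: a₁ copies of 1, then a₂ copies of 2, …,
-- then aₙ copies of n.  The index i : Fin n stands for toℕ i + 1, so a i is
-- the number of rows of length suc (toℕ i).
rowLengths : ∀ {n} → (Fin n → ℕ) → List ℕ
rowLengths a = concat (tabulate λ i → replicate (a i) (suc (toℕ i)))

numRows : ∀ {n} → (Fin n → ℕ) → ℕ
numRows a = length (rowLengths a)

numRows≡sum : ∀ {n} (a : Fin n → ℕ) → numRows a ≡ sum (tabulate a)
numRows≡sum a = go a (suc ∘ toℕ)
  where
  go : ∀ {n} (a f : Fin n → ℕ) →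
       length (concat (tabulate λ i → replicate (a i) (f i))) ≡ sum (tabulate a)
  go {0}     a f = refl
  go {suc n} a f = trans (length-++ (replicate (a zero) (f zero)))
    (cong₂ _+_ (length-replicate (a zero)) (go (a ∘ suc) (f ∘ suc)))

triangularBoard : ∀ {n} (a : Fin n → ℕ) → Board n (numRows a)
triangularBoard a (i , j) = toℕ i < lookup (rowLengths a) j

{-# OPTIONS --safe #-}

-- Call a row private to a column j if its square in column j is on the board
-- but none of its squares further right is.  Suppose the columns j ≥ m each
-- have more than j − m private rows, and the squares in columns < m attack
-- nothing.  If a placement misses a column j ≥ m, the private rows of j can
-- only be blocked by rooks in columns m, …, j − 1, so one of them is free: the
-- complex is pure.  Fix one private row of column m and shed all other squares
-- of that column.  Deleting one keeps the hypothesis; its link loses column m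
-- and one row, which is the hypothesis for m + 1.  Once column m is reduced to
-- its private square, that square attacks nothing and m can be increased.  On
-- the triangular board the rows of length j + 1 are private to column j.
module Submission where

open import Defs
open import Data.Nat.Base using (ℕ; zero; suc; _+_; _*_; _∸_; _≤_; _<_; z≤n; s≤s)
open import Data.Integer.Base using (_⊖_)
import Data.Nat.Properties as ℕ
open import Data.Fin.Base using (Fin; zero; suc; toℕ; fromℕ<; combine)
open import Data.Fin.Properties using
  (toℕ-injective; toℕ<n; toℕ-fromℕ<; combine-remQuot; remQuot-combine; any?; _≟_)
open import Data.Fin.Subset using
  (Subset; inside; outside; _∈_; _∉_; _⊆_; _∪_; _-_; ⁅_⁆; ⊥; ⊤; ∣_∣; Nonempty)
open import Data.Fin.Subset.Properties using
  ( p⊆p∪q; q⊆p∪q; x∈p∪q⁻; p─q⊆p; p─⊥≡p; x∈p∧x≢y⇒x∈p-y; x∈p⇒∣p-x∣<∣p∣; x∈⁅x⁆; x∈⁅y⁆⇒x≡y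
  ; ∣⁅x⁆∣≡1; ∣⊤∣≡n; ∣⊥∣≡0; ∈⊤; ∉⊥; _∈?_; nonempty?; Empty-unique)
open import Data.Vec.Base as Vec using (_∷_; []; here; there)
open import Data.Vec.Properties using (lookup∘tabulate; []=⇒lookup; lookup⇒[]=)
open import Data.List.Base using (List; []; _∷_; _++_; concat; replicate; tabulate; length; lookup; allFin)
open import Data.List.Membership.Propositional using () renaming (_∈_ to _∈ˡ_)
open import Data.List.Membership.Propositional.Properties using (∈-allFin)
open import Data.List.Relation.Unary.Any using (here; there)
open import Data.Product.Base using (_×_; _,_; ∃; proj₁; proj₂; map₂)
open import Data.Product.Properties using (≡-dec)
open import Data.Sum.Base using (inj₁; inj₂; [_,_]′)
open import Function.Base using (_∘_; case_of_)
open import Function.Bundles using (_⇔_; mk⇔; Equivalence)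
import Function.Properties.Equivalence as ⇔
open import Relation.Binary.Definitions using (tri<; tri≈; tri>)
open import Relation.Binary.PropositionalEquality
  using (_≡_; _≢_; refl; sym; trans; cong; subst; ≢-sym)
open import Relation.Nullary using (¬_; Dec; yes; no; does; contradiction)
open import Relation.Nullary.Decidable using (dec-true; _×-dec_; ¬?; decidable-stable)
open import Relation.Unary using (Decidable)

open Equivalence using (to; from)

-- Counting in finite subsets.

x∉p-x : ∀ {n} (p : Subset n) x → x ∉ p - x
x∉p-x (inside  ∷ p) zero    ()
x∉p-x (outside ∷ p) zero    ()
x∉p-x (_ ∷ p)       (suc x) (there x∈) = x∉p-x p x x∈

∣p∣≤1+∣p-x∣ : ∀ {n} (p : Subset n) x → ∣ p ∣ ≤ suc ∣ p - x ∣
∣p∣≤1+∣p-x∣ (inside  ∷ p) zero    = s≤s (ℕ.≤-reflexive (cong ∣_∣ (sym (p─⊥≡p p))))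
∣p∣≤1+∣p-x∣ (outside ∷ p) zero    = ℕ.m≤n⇒m≤1+n (ℕ.≤-reflexive (cong ∣_∣ (sym (p─⊥≡p p))))
∣p∣≤1+∣p-x∣ (inside  ∷ p) (suc x) = s≤s (∣p∣≤1+∣p-x∣ p x)
∣p∣≤1+∣p-x∣ (outside ∷ p) (suc x) = ∣p∣≤1+∣p-x∣ p x

∣p∣>0⇒Nonempty : ∀ {n} (p : Subset n) → 0 < ∣ p ∣ → Nonempty p
∣p∣>0⇒Nonempty {n} p 0<∣p∣ with nonempty? p
... | yes ne = ne
... | no ¬ne = contradiction (trans (cong ∣_∣ (Empty-unique ¬ne)) (∣⊥∣≡0 n)) (ℕ.>⇒≢ 0<∣p∣)

-- Induction on `p`: the partner of its first element is struck from `q`, and injectivity keeps the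
-- partners of all later elements in what remains.
injection⇒∣p∣≤∣q∣ : ∀ {a b} (R : Fin a → Fin b → Set) (p : Subset a) (q : Subset b) →
  (∀ {x} → x ∈ p → ∃ λ y → y ∈ q × R x y) →
  (∀ {x x′ y} → x ∈ p → x′ ∈ p → R x y → R x′ y → x ≡ x′) →
  ∣ p ∣ ≤ ∣ q ∣
injection⇒∣p∣≤∣q∣ R []            q f inj = z≤n
injection⇒∣p∣≤∣q∣ R (outside ∷ p) q f inj =
  injection⇒∣p∣≤∣q∣ (R ∘ suc) p q (f ∘ there)
    λ x∈ x′∈ r r′ → case inj (there x∈) (there x′∈) r r′ of λ where refl → refl
injection⇒∣p∣≤∣q∣ R (inside ∷ p) q f inj with f here
... | y₀ , y₀∈q , r₀ = ℕ.≤-<-trans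
  (injection⇒∣p∣≤∣q∣ (R ∘ suc) p (q - y₀)
    (λ x∈ → let y , y∈q , r = f (there x∈) in
      y , x∈p∧x≢y⇒x∈p-y y∈q (λ where refl → case inj here (there x∈) r₀ r of λ ()) , r)
    λ x∈ x′∈ r r′ → case inj (there x∈) (there x′∈) r r′ of λ where refl → refl)
  (x∈p⇒∣p-x∣<∣p∣ y₀∈q)

comprehension : ∀ {n} {P : Fin n → Set} → Decidable P → ∃ λ (p : Subset n) → ∀ {x} → x ∈ p ⇔ P x
comprehension {P = P} P? = p , λ {x} → mk⇔
  (λ x∈p → witness (P? x) (trans (sym (lookup∘tabulate _ x)) ([]=⇒lookup x∈p)))
  (λ Px → lookup⇒[]= x p (trans (lookup∘tabulate _ x) (dec-true (P? x) Px)))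
  where
  p = Vec.tabulate (does ∘ P?)
  witness : ∀ {A : Set} (a? : Dec A) → does a? ≡ inside → A
  witness (yes a) _ = a

-- Complexes with the same faces.

infix 4 _≋_

_≋_ : ∀ {N} → SimplicialComplex N → SimplicialComplex N → Set
Δ ≋ Γ = ∀ {τ} → Face Δ τ ⇔ Face Γ τ

-- Faces are given by predicates, so a link or deletion matches the complex of a smaller board only
-- up to logical equivalence; this carries decomposability across.
VertexDecomposable-resp-≋ : ∀ {N} {Δ Γ : SimplicialComplex N} → Δ ≋ Γ →
  VertexDecomposable Δ → VertexDecomposable Γ
VertexDecomposable-resp-≋ Δ≋Γ (simplex (inj₁ void)) =
  simplex (inj₁ λ τ → void τ ∘ from Δ≋Γ)
VertexDecomposable-resp-≋ Δ≋Γ (simplex (inj₂ (σ , Δ≡2^σ))) =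
  simplex (inj₂ (σ , λ τ → ⇔.trans (⇔.sym Δ≋Γ) (Δ≡2^σ τ)))
VertexDecomposable-resp-≋ {Δ = Δ} {Γ} Δ≋Γ (shed pure x vx vdel vlk) =
  shed (λ fσ fτ → pure (facet fσ) (facet fτ)) x (to Δ≋Γ vx)
    (VertexDecomposable-resp-≋ {Δ = del Δ x} {del Γ x}
      (mk⇔ (λ (f , x∉) → to Δ≋Γ f , x∉) (λ (f , x∉) → from Δ≋Γ f , x∉)) vdel)
    (VertexDecomposable-resp-≋ {Δ = lk Δ x} {lk Γ x}
      (mk⇔ (λ (f , x∉ , g) → to Δ≋Γ f , x∉ , to Δ≋Γ g)
           (λ (f , x∉ , g) → from Δ≋Γ f , x∉ , from Δ≋Γ g)) vlk)
  where
  facet : ∀ {σ} → IsFacet Γ σ → IsFacet Δ σ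
  facet (f , max) = from Δ≋Γ f , λ g → max (to Δ≋Γ g)

-- Deletions and links of rook complexes as smaller boards.

module _ {c r : ℕ} where

  infix 4 _⟂_

  _⟂_ : Fin c × Fin r → Fin c × Fin r → Set
  s ⟂ t = proj₁ s ≢ proj₁ t × proj₂ s ≢ proj₂ t

  ⟂-sym : ∀ {s t} → s ⟂ t → t ⟂ s
  ⟂-sym (p , q) = ≢-sym p , ≢-sym q

  square-injective : ∀ {x y : Fin (c * r)} → square {c} {r} x ≡ square y → x ≡ y
  square-injective {x} {y} eq = trans (sym (combine-remQuot {c} r x))
    (trans (cong (λ (i , j) → combine i j) eq) (combine-remQuot {c} r y))

  code : Fin c × Fin r → Fin (c * r)
  code (i , j) = combine i j

  square-code : ∀ s → square (code s) ≡ s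
  square-code (i , j) = remQuot-combine i j

  without : Board c r → Fin c × Fin r → Board c r
  without B s t = B t × t ≢ s

  unattacked : Board c r → Fin c × Fin r → Board c r
  unattacked B s t = B t × t ⟂ s

  module _ (B : Board c r) where

    insert-rook : ∀ {σ x} → Face (rookComplex B) σ → B (square x) →
      (∀ {y} → y ∈ σ → y ≢ x → square y ⟂ square x) → Face (rookComplex B) (σ ∪ ⁅ x ⁆)
    insert-rook {σ} {x} (on , na) Bx free =
      (λ y∈ → [ on , (λ y∈x → subst (B ∘ square) (sym (x∈⁅y⁆⇒x≡y x y∈x)) Bx) ]′ (x∈p∪q⁻ σ ⁅ x ⁆ y∈)) ,
      λ y∈ z∈ → attack (x∈p∪q⁻ σ ⁅ x ⁆ y∈) (x∈p∪q⁻ σ ⁅ x ⁆ z∈)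
      where
      attack : ∀ {y z} → _ → _ → y ≢ z → square y ⟂ square z
      attack (inj₁ y∈) (inj₁ z∈) y≢z = na y∈ z∈ y≢z
      attack (inj₁ y∈) (inj₂ z∈) y≢z with refl ← x∈⁅y⁆⇒x≡y x z∈ = free y∈ y≢z
      attack (inj₂ y∈) (inj₁ z∈) y≢z with refl ← x∈⁅y⁆⇒x≡y x y∈ = ⟂-sym (free z∈ (≢-sym y≢z))
      attack (inj₂ y∈) (inj₂ z∈) y≢z =
        contradiction (trans (x∈⁅y⁆⇒x≡y x y∈) (sym (x∈⁅y⁆⇒x≡y x z∈))) y≢z

    facet-absorbs : ∀ {σ x} → IsFacet (rookComplex B) σ → B (square x) →
      (∀ {y} → y ∈ σ → y ≢ x → square y ⟂ square x) → x ∈ σ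
    facet-absorbs {σ} {x} (face , max) Bx free =
      subst (x ∈_) (max (insert-rook face Bx free) (p⊆p∪q ⁅ x ⁆)) (q⊆p∪q σ ⁅ x ⁆ (x∈⁅x⁆ x))

    isVertex : ∀ {x} → B (square x) → IsVertex (rookComplex B) x
    isVertex {x} Bx =
      (λ y∈ → subst (B ∘ square) (sym (x∈⁅y⁆⇒x≡y x y∈)) Bx) ,
      λ y∈ z∈ y≢z → contradiction (trans (x∈⁅y⁆⇒x≡y x y∈) (sym (x∈⁅y⁆⇒x≡y x z∈))) y≢z

    without≋del : ∀ x → rookComplex (without B (square x)) ≋ del (rookComplex B) x
    without≋del x = mk⇔
      (λ (on , na) → ((proj₁ ∘ on) , na) , λ x∈ → proj₂ (on x∈) refl)
      (λ ((on , na) , x∉) →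
        (λ y∈ → on y∈ , λ eq → x∉ (subst (_∈ _) (square-injective eq) y∈)) , na)

    -- A rook on `x` can join a placement avoiding `x` exactly when no rook there shares its row or
    -- column. Links thus stay rook complexes, and the induction can run over boards.
    unattacked≋lk : ∀ {x} → B (square x) →
      rookComplex (unattacked B (square x)) ≋ lk (rookComplex B) x
    unattacked≋lk {x} Bx = mk⇔
      (λ (on , na) → ((proj₁ ∘ on) , na) , (λ x∈ → proj₁ (proj₂ (on x∈)) refl) ,
        insert-rook ((proj₁ ∘ on) , na) Bx (λ y∈ _ → proj₂ (on y∈)))
      (λ ((on , na) , x∉ , (_ , na∪)) →
        (λ y∈ → on y∈ , na∪ (p⊆p∪q ⁅ x ⁆ y∈) (q⊆p∪q _ ⁅ x ⁆ (x∈⁅x⁆ x)) λ where refl → x∉ y∈) , na)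

  -- Staircase boards and purity.

  PrivateRow : Board c r → Fin c → Fin r → Set
  PrivateRow B j ρ = B (j , ρ) × (∀ k → toℕ j < toℕ k → ¬ B (k , ρ))

  -- In `settled` only `s` is confined to the columns below `m`; `t` may lie anywhere. The bound in
  -- `privateRows` is |D| > j - m, stated without truncated subtraction.
  record Staircase (m : ℕ) (B : Board c r) : Set where
    field
      settled : ∀ {s t} → B s → B t → toℕ (proj₁ s) < m → s ≢ t → s ⟂ t
      privateRows : ∀ j → m ≤ toℕ j →
        ∃ λ D → (∀ {ρ} → ρ ∈ D → PrivateRow B j ρ) × toℕ j < m + ∣ D ∣

  open Staircase

  module _ {m : ℕ} {B : Board c r} (stair : Staircase m B) where

    facet-meets-column : ∀ {σ} → IsFacet (rookComplex B) σ → ∀ j → m ≤ toℕ j →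
      ∃ λ y → y ∈ σ × column {c} {r} y ≡ j
    facet-meets-column {σ} facet@((on , na) , _) j m≤j
      with any? (λ y → (y ∈? σ) ×-dec (column {c} {r} y ≟ j))
    ... | yes meets = meets
    ... | no ¬meets with privateRows stair j m≤j
    -- Pigeonhole: if `σ` misses column `j`, the rows of `D` inject into the columns m, ..., j - 1,
    -- coded as `Fin (toℕ j ∸ m)` by subtracting `m`.
    ... | D , priv , j<m+∣D∣ = contradiction j<m+∣D∣ (ℕ.≤⇒≯ (begin
      m + ∣ D ∣             ≤⟨ ℕ.+-monoʳ-≤ m (injection⇒∣p∣≤∣q∣ Blocks D ⊤ blocker Blocks-injective) ⟩
      m + ∣ ⊤ {toℕ j ∸ m} ∣ ≡⟨ cong (m +_) (∣⊤∣≡n (toℕ j ∸ m)) ⟩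
      m + (toℕ j ∸ m)       ≡⟨ ℕ.m+[n∸m]≡n m≤j ⟩
      toℕ j                 ∎))
      where
      open ℕ.≤-Reasoning

      Blocks : Fin r → Fin (toℕ j ∸ m) → Set
      Blocks ρ k = ∃ λ y → y ∈ σ × row {c} {r} y ≡ ρ × toℕ (column {c} {r} y) ≡ m + toℕ k

      Blocks-injective : ∀ {ρ ρ′ k} → ρ ∈ D → ρ′ ∈ D → Blocks ρ k → Blocks ρ′ k → ρ ≡ ρ′
      Blocks-injective _ _ (y , y∈ , refl , cy) (z , z∈ , refl , cz) with y ≟ z
      ... | yes refl = refl
      ... | no y≢z = contradiction (toℕ-injective (trans cy (sym cz))) (proj₁ (na y∈ z∈ y≢z))

      blocker : ∀ {ρ} → ρ ∈ D → ∃ λ k → k ∈ ⊤ × Blocks ρ k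
      blocker {ρ} ρ∈D with any? (λ y → (y ∈? σ) ×-dec (row {c} {r} y ≟ ρ))
      -- With both row `ρ` and column `j` free of rooks, maximality puts (j, ρ) into `σ`, so column
      -- `j` is met after all.
      ... | no ¬blocked = contradiction
        ( code (j , ρ)
        , facet-absorbs B facet (subst B (sym (square-code (j , ρ))) (proj₁ (priv ρ∈D)))
            (λ {y} y∈ _ → subst (square y ⟂_) (sym (square-code (j , ρ)))
              ((λ eq → ¬meets (y , y∈ , eq)) , λ eq → ¬blocked (y , y∈ , eq)))
        , cong proj₁ (square-code (j , ρ)))
        ¬meets
      ... | yes (y , y∈ , refl) = fromℕ< k<j∸m , ∈⊤ , y , y∈ , refl ,
        sym (trans (cong (m +_) (toℕ-fromℕ< k<j∸m)) (ℕ.m+[n∸m]≡n m≤k))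
        where
        k≢j : column y ≢ j
        k≢j eq = ¬meets (y , y∈ , eq)

        -- A blocker left of column `m` would be settled, yet it shares row `ρ` with the board
        -- square (j, ρ).
        m≤k : m ≤ toℕ (column y)
        m≤k = ℕ.≮⇒≥ λ k<m →
          proj₂ (settled stair (on y∈) (proj₁ (priv ρ∈D)) k<m (k≢j ∘ cong proj₁)) refl

        k<j : toℕ (column y) < toℕ j
        k<j = ℕ.≤∧≢⇒< (ℕ.≮⇒≥ λ j<k → proj₂ (priv ρ∈D) (column y) j<k (on y∈)) (k≢j ∘ toℕ-injective)

        k<j∸m : toℕ (column y) ∸ m < toℕ j ∸ m
        k<j∸m = ℕ.∸-monoˡ-< k<j m≤k

    -- Every facet meets each column from `m` on. A rook of `σ` further left attacks nothing on the
    -- board, so `τ` already contains it.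
    facets-occupy-same-columns : ∀ {σ τ} → IsFacet (rookComplex B) σ → IsFacet (rookComplex B) τ →
      ∀ {x} → x ∈ σ → ∃ λ y → y ∈ τ × column {c} {r} x ≡ column {c} {r} y
    facets-occupy-same-columns ((onσ , _) , _) fτ@((onτ , _) , _) {x} x∈ with m ℕ.≤? toℕ (column {c} {r} x)
    ... | yes m≤ = map₂ (map₂ sym) (facet-meets-column fτ (column x) m≤)
    ... | no  m≰ = x , facet-absorbs B fτ (onσ x∈)
      (λ y∈ y≢x → ⟂-sym (settled stair (onσ x∈) (onτ y∈) (ℕ.≰⇒> m≰)
        (y≢x ∘ sym ∘ square-injective))) , refl

    pure : Pure (rookComplex B)
    pure fσ fτ = cong (_⊖ 1) (ℕ.≤-antisym (size fσ fτ) (size fτ fσ))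
      where
      size : ∀ {σ τ} → IsFacet (rookComplex B) σ → IsFacet (rookComplex B) τ → ∣ σ ∣ ≤ ∣ τ ∣
      size {σ} {τ} fσ@((_ , na) , _) fτ =
        injection⇒∣p∣≤∣q∣ (λ x y → column {c} {r} x ≡ column {c} {r} y) σ τ (facets-occupy-same-columns fσ fτ)
          (λ {x} {x′} x∈ x′∈ e e′ → decidable-stable (x ≟ x′)
            λ x≢x′ → proj₁ (na x∈ x′∈ x≢x′) (trans e (sym e′)))

    -- Losing the row of `s` costs each later column at most one private row, and passing from `m`
    -- to m + 1 lowers the number required by one.
    Staircase-unattacked : ∀ s → toℕ (proj₁ s) ≡ m → Staircase (suc m) (unattacked B s)
    Staircase-unattacked s s≡m .settled (Bt , t⟂s) (Bu , _) t≤m =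
      settled stair Bt Bu (ℕ.≤∧≢⇒< (ℕ.≤-pred t≤m)
        λ eq → proj₁ t⟂s (toℕ-injective (trans eq (sym s≡m))))
    Staircase-unattacked s@(_ , ρ₀) s≡m .privateRows j m<j with privateRows stair j (ℕ.<⇒≤ m<j)
    ... | D , priv , j<m+∣D∣ =
      D - ρ₀ ,
      (λ ρ∈ → let Bρ , ¬Bρ = priv (p─q⊆p D ⁅ ρ₀ ⁆ ρ∈) in
        (Bρ , (λ eq → ℕ.>⇒≢ m<j (trans (cong toℕ eq) s≡m)) , λ where refl → x∉p-x D ρ₀ ρ∈) ,
        λ k j<k → ¬Bρ k j<k ∘ proj₁) ,
      ℕ.<-≤-trans j<m+∣D∣ (ℕ.≤-trans (ℕ.+-monoʳ-≤ m (∣p∣≤1+∣p-x∣ D ρ₀))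
        (ℕ.≤-reflexive (ℕ.+-suc m ∣ D - ρ₀ ∣)))

    -- At column `m` a single private row suffices, and `d` survives. Every other column keeps its
    -- squares, and a deletion cannot fill the space to the right of a private square.
    Staircase-without : ∀ {j ρ d} → toℕ j ≡ m → PrivateRow B j d → d ≢ ρ →
      Staircase m (without B (j , ρ))
    Staircase-without _ _ _ .settled (Bs , _) (Bt , _) = settled stair Bs Bt
    Staircase-without {j} {ρ} {d} j≡m (Bd , ¬Bd) d≢ρ .privateRows k m≤k with k ≟ j
    ... | yes refl = ⁅ d ⁆ ,
      (λ ρ∈ → case x∈⁅y⁆⇒x≡y d ρ∈ of λ where
        refl → (Bd , d≢ρ ∘ cong proj₂) , λ k j<k → ¬Bd k j<k ∘ proj₁) ,
      ℕ.≤-reflexive (trans (cong suc j≡m) (trans (ℕ.+-comm 1 m) (cong (m +_) (sym (∣⁅x⁆∣≡1 d)))))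
    ... | no k≢j with privateRows stair k m≤k
    ... | D , priv , k<m+∣D∣ = D ,
      (λ ρ∈ → let Bρ , ¬Bρ = priv ρ∈ in
        (Bρ , k≢j ∘ cong proj₁) , λ i k<i → ¬Bρ i k<i ∘ proj₁) ,
      k<m+∣D∣

    -- The square (j, d) is alone in its column, has nothing to its right because `d` is private,
    -- and is not attacked from the left because those squares are settled. For later columns the
    -- same `D` meets a weaker bound.
    Staircase-suc : ∀ {j d} → toℕ j ≡ m → PrivateRow B j d →
      (∀ {ρ} → B (j , ρ) → ρ ≡ d) → Staircase (suc m) B
    Staircase-suc {j} {d} j≡m (Bd , ¬Bd) only-d .settled {s} {t} Bs Bt s≤m s≢t
      with ℕ.m≤n⇒m<n∨m≡n (ℕ.≤-pred s≤m)
    ... | inj₁ s<m = settled stair Bs Bt s<m s≢t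
    ... | inj₂ s≡m with refl ← toℕ-injective (trans s≡m (sym j≡m)) with refl ← only-d Bs
      with ℕ.<-cmp (toℕ (proj₁ t)) (toℕ j)
    ... | tri< t<j _ _ = ⟂-sym (settled stair Bt Bs (subst (_ <_) j≡m t<j) (≢-sym s≢t))
    ... | tri≈ _ t≡j _ with refl ← toℕ-injective t≡j =
      contradiction (cong (j ,_) (sym (only-d Bt))) s≢t
    ... | tri> _ _ t>j = (λ eq → ℕ.>⇒≢ t>j (cong toℕ (sym eq))) , λ where refl → ¬Bd _ t>j Bt
    Staircase-suc _ _ _ .privateRows k m<k with privateRows stair k (ℕ.<⇒≤ m<k)
    ... | D , priv , k<m+∣D∣ = D , priv , ℕ.m≤n⇒m≤1+n k<m+∣D∣

  -- Shedding column by column.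

  settled⇒simplex : ∀ {B : Board c r} → Decidable B → Staircase c B → IsSimplex (rookComplex B)
  settled⇒simplex {B} B? stair with comprehension (B? ∘ square)
  ... | V , V≡B = inj₂ (V , λ τ → mk⇔ (λ (on , _) x∈ → from V≡B (on x∈)) (face τ))
    where
    face : ∀ τ → τ ⊆ V → Face (rookComplex B) τ
    face τ τ⊆V = (λ x∈ → to V≡B (τ⊆V x∈)) , λ {x} x∈ y∈ x≢y →
      settled stair (to V≡B (τ⊆V x∈)) (to V≡B (τ⊆V y∈)) (toℕ<n (column {c} {r} x))
        (x≢y ∘ square-injective)

  without? : ∀ {B : Board c r} → Decidable B → ∀ s → Decidable (without B s)
  without? B? s t = B? t ×-dec ¬? (≡-dec _≟_ _≟_ t s)

  unattacked? : ∀ {B : Board c r} → Decidable B → ∀ s → Decidable (unattacked B s)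
  unattacked? B? s t = B? t ×-dec (¬? (proj₁ t ≟ proj₁ s) ×-dec ¬? (proj₂ t ≟ proj₂ s))

  shed-square : ∀ {m} {B : Board c r} → Staircase m B → ∀ s → B s →
    VertexDecomposable (rookComplex (without B s)) →
    VertexDecomposable (rookComplex (unattacked B s)) →
    VertexDecomposable (rookComplex B)
  shed-square {B = B} stair s Bs vdel vlk =
    -- Vertices are codes, and `square (code s)` equals `s` only propositionally, so the claim is
    -- proved for the former and transported.
    subst Shed (square-code s) shed-code Bs vdel vlk
    where
    Shed : Fin c × Fin r → Set₁
    Shed t = B t → VertexDecomposable (rookComplex (without B t)) →
      VertexDecomposable (rookComplex (unattacked B t)) → VertexDecomposable (rookComplex B)

    shed-code : Shed (square (code s))
    shed-code Bx vdel vlk = shed (pure stair) (code s) (isVertex B Bx)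
      (VertexDecomposable-resp-≋ (without≋del B (code s)) vdel)
      (VertexDecomposable-resp-≋ (unattacked≋lk B Bx) vlk)

  module _ {m : ℕ} (m<c : m < c)
    (ih : ∀ {B : Board c r} → Decidable B → Staircase (suc m) B → VertexDecomposable (rookComplex B))
    where

    private
      j = fromℕ< m<c
      j≡m = toℕ-fromℕ< m<c

    -- The list holds the rows still to be examined and drives the recursion; when it is empty, (j,
    -- d) is the only square left in column `j`.
    shed-column : ∀ (ρs : List (Fin r)) {B : Board c r} → Decidable B → Staircase m B →
      ∀ {d} → PrivateRow B j d → (∀ {ρ} → B (j , ρ) → ρ ≢ d → ρ ∈ˡ ρs) →
      VertexDecomposable (rookComplex B)
    shed-column [] B? stair {d} priv rest = ih B? (Staircase-suc stair j≡m priv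
      λ {ρ} Bρ → decidable-stable (ρ ≟ d) λ ρ≢d → case rest Bρ ρ≢d of λ ())
    shed-column (ρ ∷ ρs) B? stair {d} priv@(Bd , ¬Bd) rest with B? (j , ρ) ×-dec ¬? (ρ ≟ d)
    ... | yes (Bρ , ρ≢d) = shed-square stair (j , ρ) Bρ
      (shed-column ρs (without? B? (j , ρ)) (Staircase-without stair j≡m priv (≢-sym ρ≢d))
        ((Bd , ρ≢d ∘ sym ∘ cong proj₂) , λ k j<k → ¬Bd k j<k ∘ proj₁)
        λ (Bρ′ , ne) ρ′≢d → case rest Bρ′ ρ′≢d of λ where
          (here refl) → contradiction refl ne
          (there ρ′∈) → ρ′∈)
      -- A rook on (j, ρ) clears all of column `j`, so the link passes straight to m + 1.
      (ih (unattacked? B? (j , ρ)) (Staircase-unattacked stair (j , ρ) j≡m))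
    ... | no ¬shed = shed-column ρs B? stair priv
      λ Bρ′ ρ′≢d → case rest Bρ′ ρ′≢d of λ where
        (here refl) → contradiction (Bρ′ , ρ′≢d) ¬shed
        (there ρ′∈) → ρ′∈

  -- Induction on the number `k` of columns not yet settled; at zero no two squares attack each
  -- other and the complex is a simplex.
  Staircase⇒VertexDecomposable : ∀ k {m} → m + k ≡ c → {B : Board c r} → Decidable B →
    Staircase m B → VertexDecomposable (rookComplex B)
  Staircase⇒VertexDecomposable zero {m} eq B? stair with refl ← trans (sym (ℕ.+-identityʳ m)) eq =
    simplex (settled⇒simplex B? stair)
  Staircase⇒VertexDecomposable (suc k) {m} eq {B} B? stair =
    shed-column m<c (Staircase⇒VertexDecomposable k 1+m+k≡c) (allFin r) B? stair
      (priv (proj₂ D-nonempty)) (λ _ _ → ∈-allFin _)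
    where
    1+m+k≡c : suc m + k ≡ c
    1+m+k≡c = trans (sym (ℕ.+-suc m k)) eq

    m<c : m < c
    m<c = subst (m <_) 1+m+k≡c (s≤s (ℕ.m≤m+n m k))

    j≡m = toℕ-fromℕ< m<c

    rows = privateRows stair (fromℕ< m<c) (ℕ.≤-reflexive (sym j≡m))
    priv = proj₁ (proj₂ rows)

    D-nonempty : Nonempty (proj₁ rows)
    -- For column `m` itself the bound reads m < m + |D|, which yields the private row to be kept.
    D-nonempty = ∣p∣>0⇒Nonempty _ (ℕ.+-cancelˡ-< m 0 _
      (subst (_< m + ∣ proj₁ rows ∣) (trans j≡m (sym (ℕ.+-identityʳ m))) (proj₂ (proj₂ rows))))

-- Private rows of the triangular board.

Occurs : ℕ → ℕ → List ℕ → Set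
Occurs k v xs = ∃ λ (D : Subset (length xs)) → (∀ {ρ} → ρ ∈ D → lookup xs ρ ≡ v) × k ≤ ∣ D ∣

Occurs-∷ : ∀ {k v xs} x → Occurs k v xs → Occurs k v (x ∷ xs)
Occurs-∷ x (D , occ , k≤) = outside ∷ D , (λ where (there ρ∈) → occ ρ∈) , k≤

Occurs-replicate : ∀ k v xs → Occurs k v (replicate k v ++ xs)
Occurs-replicate zero    v xs = ⊥ , (λ ρ∈ → contradiction ρ∈ ∉⊥) , z≤n
Occurs-replicate (suc k) v xs with Occurs-replicate k v xs
... | D , occ , k≤ = inside ∷ D , (λ where here → refl ; (there ρ∈) → occ ρ∈) , s≤s k≤

Occurs-++ : ∀ {k v ys} xs → Occurs k v ys → Occurs k v (xs ++ ys)
Occurs-++ []       occ = occ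
Occurs-++ (x ∷ xs) occ = Occurs-∷ x (Occurs-++ xs occ)

Occurs-concat : ∀ {n} (a f : Fin n → ℕ) i →
  Occurs (a i) (f i) (concat (tabulate λ i → replicate (a i) (f i)))
Occurs-concat a f zero    = Occurs-replicate (a zero) (f zero) _
Occurs-concat a f (suc i) =
  Occurs-++ (replicate (a zero) (f zero)) (Occurs-concat (a ∘ suc) (f ∘ suc) i)

triangularBoard-Staircase : ∀ {n} (a : Fin n → ℕ) → (∀ i → suc (toℕ i) ≤ a i) →
  Staircase 0 (triangularBoard a)
triangularBoard-Staircase a a≥ .Staircase.settled _ _ ()
triangularBoard-Staircase a a≥ .Staircase.privateRows j _
  with Occurs-concat a (suc ∘ toℕ) j
... | D , occ , a≤ = D ,
  -- Columns count from 0, so a row of length j + 1 ends exactly at column `j`.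
  (λ ρ∈ → ℕ.≤-reflexive (sym (occ ρ∈)) ,
    λ k j<k k< → ℕ.<⇒≱ j<k (ℕ.≤-pred (subst (_ <_) (occ ρ∈) k<))) ,
  -- With m = 0 the required bound j < |D| is just the hypothesis that at least j + 1 rows have
  -- length j + 1.
  ℕ.≤-trans (a≥ j) a≤

theorem3p1 : (n : ℕ) → 1 ≤ n → (a : Fin n → ℕ) → (∀ i → suc (toℕ i) ≤ a i) →
    VertexDecomposable (rookComplex (triangularBoard a))
theorem3p1 n _ a a≥ = Staircase⇒VertexDecomposable n refl
  (λ (i , j) → toℕ i ℕ.<? lookup (rowLengths a) j) (triangularBoard-Staircase a a≥)
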